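{- The minimum number of edges of a $5$-uniform intersecting hypergraph $H$ with $\tau(H)=5$ is $13$. That is, there exists a $5$-uniform intersecting hypergraph with exactly $13$ edges and covering number $5$, and every $5$-uniform intersecting hypergraph with covering number $5$ has at least $13$ edges.
   Context: Hypergraphs are finite and simple (no repeated edges). A hypergraph is $r$-uniform if every edge has exactly $r$ vertices, and intersecting if any two edges share at least one vertex. A cover of $H$ is a set of vertices meeting every edge; the covering number $\tau(H)$ is the minimum size of a cover. For an $r$-uniform intersecting hypergraph every edge is a cover, so $\tau(H)\le r$. -}

module Defs where

open import Data.Nat using (ℕ; _≤_)
open import Data.Fin.Subset using (Subset; _∩_; ∣_∣; Nonempty)
open import Data.List using (List; length)
open import Data.List.Membership.Propositional using (_∈_)
open import Data.List.Relation.Unary.All using (All)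
open import Data.List.Relation.Unary.Unique.Propositional using (Unique)
open import Data.Product using (Σ; _×_)
open import Relation.Binary.PropositionalEquality using (_≡_)

record Hypergraph : Set where
  field
    n      : ℕ
    edges  : List (Subset n)
    simple : Unique edges
open Hypergraph public

∣E∣ : Hypergraph → ℕ
∣E∣ H = length (edges H)

Uniform : ℕ → Hypergraph → Set
Uniform r H = All (λ e → ∣ e ∣ ≡ r) (edges H)

Intersecting : Hypergraph → Set
Intersecting H = ∀ {e f} → e ∈ edges H → f ∈ edges H → Nonempty (e ∩ f)

IsCover : (H : Hypergraph) → Subset (n H) → Set
IsCover H C = All (λ e → Nonempty (C ∩ e)) (edges H)

CoveringNumber : Hypergraph → ℕ → Set
CoveringNumber H k =
  Σ (Subset (n H)) (λ C → IsCover H C × ∣ C ∣ ≡ k)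
  × (∀ (C : Subset (n H)) → IsCover H C → k ≤ ∣ C ∣)

{-# OPTIONS --safe #-}

-- Lower bound.  A pigeonhole count on the vertices of one edge of a 12-edge family yields a vertex
-- missed by at most 8 edges; it remains to cover 8 pairwise intersecting 5-sets by 3
-- vertices.  Suppose this is impossible.  Covering the remaining edges in pairs shows that a vertex
-- lies in at most 3 of the 8 edges, and that the triples of edges having a common vertex pairwise
-- intersect.  If t is such a triple, with common vertex p, and e ∈ t, then e meets the 5 edges
-- outside t in its 4 vertices other than p, so two of these edges share a vertex with e: some
-- triple c has c ∩ t = {e}.  Likewise every edge lies in a triple.  A backtracking search, run by
-- the type checker, finds no system of triples on 8 points with these properties.

module Submission where

open import Defs
open import Data.Nat using (_≤_)
open import Data.Product using (Σ; _×_)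
open import Relation.Binary.PropositionalEquality using (_≡_)

open import Data.Bool.Base using (Bool; true; false; _∧_; T; if_then_else_)
open import Data.Bool.ListAction using (all)
import Data.Bool.Properties as Bool
open import Data.Empty using (⊥)
open import Data.Fin.Base using (Fin; zero; suc)
import Data.Fin.Properties as Fin
open import Data.Fin.Subset
  using (Subset; inside; outside; _∩_; _∪_; ∁; ⋃; _-_; ∣_∣; ⁅_⁆; Nonempty; _∈_; _∉_; _⊆_)
open import Data.Fin.Subset.Properties
open import Data.List.Base
  using (List; []; _∷_; _++_; map; filter; length; allFin; tabulate)
open import Data.List.Membership.Propositional using (find) renaming (_∈_ to _∈ˡ_)
open import Data.List.Membership.Propositional.Properties
  using (∈-filter⁺; ∈-filter⁻; ∈-allFin; ∈-map⁺; ∈-++⁺ˡ; ∈-++⁺ʳ)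
open import Data.List.Properties using (map-tabulate; length-filter; length-++)
open import Data.List.Relation.Binary.Sublist.Propositional.Properties
  using (length-mono-≤; filter-⊆) renaming (filter⁺ to filter⁺-⊆)
open import Data.List.Relation.Unary.All as All using (All; []; _∷_; all?)
import Data.List.Relation.Unary.All.Properties as All
open import Data.List.Relation.Unary.Any as Any using (Any; here; there; any?)
import Data.List.Relation.Unary.Any.Properties as Any
open import Data.List.Relation.Unary.Unique.DecPropositional using (unique?)
open import Data.Nat.Base
  using (ℕ; zero; suc; _+_; _*_; _∸_; _<_; _≤ᵇ_; z≤n; s≤s; s≤s⁻¹)
import Data.Nat.Properties as ℕ
open import Data.Nat.DivMod using (_mod_)
open import Data.Product.Base using (∃; ∃₂; _,_; proj₁; proj₂)
open import Data.Sum.Base using (_⊎_; inj₁; inj₂; [_,_]′)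
import Data.Vec.Base as Vec
open import Data.Vec.Base using (here; there)
open import Data.Vec.Properties using (≡-dec)
open import Function.Base using (_∘_; id)
open import Relation.Binary.Definitions using (DecidableEquality)
open import Relation.Binary.PropositionalEquality
  using (_≢_; refl; sym; trans; cong; subst; subst₂)
open import Relation.Nullary using (¬_; yes; no; contradiction)
open import Relation.Nullary.Decidable using (does; ¬?; _×-dec_; from-yes; from-no)
open import Relation.Unary using (Decidable)

-- Finite sets and lists

_≟ˢ_ : ∀ {n} → DecidableEquality (Subset n)
_≟ˢ_ = ≡-dec Bool._≟_

elements : ∀ {n} → Subset n → List (Fin n)
elements p = filter (_∈? p) (allFin _)

length-elements : ∀ {n} (p : Subset n) → length (elements p) ≡ ∣ p ∣
length-elements Vec.[]              = refl
length-elements {suc n} (s Vec.∷ p) = go s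
  where
  shift : ∀ s xs → length (filter (_∈? (s Vec.∷ p)) (map suc xs)) ≡ length (filter (_∈? p) xs)
  shift s []       = refl
  shift s (x ∷ xs) with does (x ∈? p)
  ... | true  = cong suc (shift s xs)
  ... | false = shift s xs
  tail : ∀ s → length (filter (_∈? (s Vec.∷ p)) (tabulate suc)) ≡ ∣ p ∣
  tail s = trans (cong (length ∘ filter (_∈? (s Vec.∷ p))) (sym (map-tabulate id suc)))
                 (trans (shift s (allFin n)) (length-elements p))
  go : ∀ s → length (elements (s Vec.∷ p)) ≡ ∣ s Vec.∷ p ∣
  go inside  = cong suc (tail inside)
  go outside = tail outside

∈-elements⁺ : ∀ {n} {p : Subset n} {x} → x ∈ p → x ∈ˡ elements p
∈-elements⁺ {p = p} x∈p = ∈-filter⁺ (_∈? p) (∈-allFin _) x∈p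

∈-elements⁻ : ∀ {n} {p : Subset n} {x} → x ∈ˡ elements p → x ∈ p
∈-elements⁻ {p = p} x∈ = proj₂ (∈-filter⁻ (_∈? p) {xs = allFin _} x∈)

subsets : ∀ n → List (Subset n)
subsets zero    = Vec.[] ∷ []
subsets (suc n) = map (inside Vec.∷_) (subsets n) ++ map (outside Vec.∷_) (subsets n)

∈-subsets : ∀ {n} (p : Subset n) → p ∈ˡ subsets n
∈-subsets Vec.[]              = here refl
∈-subsets (inside  Vec.∷ p) = ∈-++⁺ˡ (∈-map⁺ _ (∈-subsets p))
∈-subsets (outside Vec.∷ p) = ∈-++⁺ʳ _ (∈-map⁺ _ (∈-subsets p))

∣⁅x⁆∪p∣≡1+∣p∣ : ∀ {n} {x : Fin n} {p} → x ∉ p → ∣ ⁅ x ⁆ ∪ p ∣ ≡ suc ∣ p ∣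
∣⁅x⁆∪p∣≡1+∣p∣ {x = zero}  {inside  Vec.∷ p} x∉p = contradiction here x∉p
∣⁅x⁆∪p∣≡1+∣p∣ {x = zero}  {outside Vec.∷ p} x∉p = cong (suc ∘ ∣_∣) (∪-identityˡ p)
∣⁅x⁆∪p∣≡1+∣p∣ {x = suc x} {inside  Vec.∷ p} x∉p = cong suc (∣⁅x⁆∪p∣≡1+∣p∣ (x∉p ∘ there))
∣⁅x⁆∪p∣≡1+∣p∣ {x = suc x} {outside Vec.∷ p} x∉p = ∣⁅x⁆∪p∣≡1+∣p∣ (x∉p ∘ there)

∣⁅x⁆∪p∣≤1+∣p∣ : ∀ {n} (x : Fin n) p → ∣ ⁅ x ⁆ ∪ p ∣ ≤ suc ∣ p ∣
∣⁅x⁆∪p∣≤1+∣p∣ x p with x ∈? p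
... | no  x∉p = ℕ.≤-reflexive (∣⁅x⁆∪p∣≡1+∣p∣ x∉p)
... | yes x∈p = ℕ.m≤n⇒m≤1+n (p⊆q⇒∣p∣≤∣q∣ λ {y} y∈ →
  [ (λ y∈⁅x⁆ → subst (_∈ p) (sym (x∈⁅y⁆⇒x≡y x y∈⁅x⁆)) x∈p) , id ]′ (x∈p∪q⁻ ⁅ x ⁆ p y∈))

-- Induction on `U`: if no later element shares the value of the first, that value is deleted from
-- `F`, and both sets shrink.
subset-pigeonhole : ∀ {m n} (U : Subset m) (F : Subset n) (f : Fin m → Fin n) →
                    (∀ {a} → a ∈ U → f a ∈ F) → ∣ F ∣ < ∣ U ∣ →
                    ∃₂ λ a b → a ∈ U × b ∈ U × a ≢ b × f a ≡ f b
subset-pigeonhole Vec.[] F f f∈F ()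
subset-pigeonhole (outside Vec.∷ U) F f f∈F F<U
  with a , b , a∈ , b∈ , a≢b , eq ← subset-pigeonhole U F (f ∘ suc) (f∈F ∘ there) F<U
  = suc a , suc b , there a∈ , there b∈ , a≢b ∘ Fin.suc-injective , eq
subset-pigeonhole (inside Vec.∷ U) F f f∈F F<U
  with Fin.any? (λ b → (b ∈? U) ×-dec (f zero Fin.≟ f (suc b)))
... | yes (b , b∈ , eq) = zero , suc b , here , there b∈ , (λ ()) , eq
... | no  fresh
  with a , b , a∈ , b∈ , a≢b , eq ← subset-pigeonhole U (F - f zero) (f ∘ suc)
         (λ a∈ → x∈p∧x≢y⇒x∈p-y (f∈F (there a∈)) (λ eq → fresh (_ , a∈ , sym eq)))
         (ℕ.<-≤-trans (x∈p⇒∣p-x∣<∣p∣ (f∈F here)) (s≤s⁻¹ F<U))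
  = suc a , suc b , there a∈ , there b∈ , a≢b ∘ Fin.suc-injective , eq

length-filter-split : ∀ {A : Set} {P : A → Set} (P? : Decidable P) xs →
                      length xs ≡ length (filter P? xs) + length (filter (¬? ∘ P?) xs)
length-filter-split P? []       = refl
length-filter-split P? (x ∷ xs) with P? x
... | yes _ = cong suc (length-filter-split P? xs)
... | no  _ = trans (cong suc (length-filter-split P? xs)) (sym (ℕ.+-suc _ _))

-- Each member of `xs` is charged to the first vertex of `ps` that it contains; every vertex is
-- charged at most `k` times.
union-bound : ∀ {n} k (ps : List (Fin n)) (xs : List (Subset n)) →
              (∀ {p} → p ∈ˡ ps → length (filter (p ∈?_) xs) ≤ k) →
              (∀ {x} → x ∈ˡ xs → Any (_∈ x) ps) →
              length xs ≤ length ps * k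
union-bound k []       []       few hit = z≤n
union-bound k []       (x ∷ xs) few hit = contradiction (hit (here refl)) λ ()
union-bound k (p ∷ ps) xs       few hit =
  subst (_≤ k + length ps * k) (sym (length-filter-split (p ∈?_) xs))
    (ℕ.+-mono-≤ (few (here refl)) (union-bound k ps missed few′ hit′))
  where
  missed = filter (¬? ∘ (p ∈?_)) xs
  few′ : ∀ {q} → q ∈ˡ ps → length (filter (q ∈?_) missed) ≤ k
  few′ {q} q∈ = ℕ.≤-trans
    (length-mono-≤ (filter⁺-⊆ (q ∈?_) (q ∈?_) (λ { refl → id }) (filter-⊆ (¬? ∘ (p ∈?_)) xs)))
    (few (there q∈))
  hit′ : ∀ {x} → x ∈ˡ missed → Any (_∈ x) ps
  hit′ x∈ with x∈xs , p∉x ← ∈-filter⁻ (¬? ∘ (p ∈?_)) {xs = xs} x∈ | hit x∈xs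
  ... | here  p∈x = contradiction p∈x p∉x
  ... | there q∈x = q∈x

-- Otherwise each vertex of `e` is missed by at least 9 members of `es`, so it lies in at most
-- `length es ∸ 9` of them, while the five vertices of `e` together meet all of `es`.
popular-vertex : ∀ {n} (e : Subset n) (es : List (Subset n)) → ∣ e ∣ ≡ 5 → length es ≤ 11 →
                 (∀ {f} → f ∈ˡ e ∷ es → Nonempty (e ∩ f)) →
                 ∃ λ p → p ∈ e × length (filter (¬? ∘ (p ∈?_)) es) ≤ 8
popular-vertex e es ∣e∣≡5 ∣es∣≤11 meet
  with Fin.any? (λ p → (p ∈? e) ×-dec (length (filter (¬? ∘ (p ∈?_)) es) ℕ.≤? 8))
... | yes found = found
-- Two rounds of `shrink` lower the bound from 11 to 5 * 2 = 10 and then to 5 * 1 = 5.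
... | no  none  = contradiction (ℕ.≤-trans 9≤∣es∣ (shrink (shrink ∣es∣≤11))) (from-no (9 ℕ.≤? 5))
  where
  missed : ∀ {p} → p ∈ e → 9 ≤ length (filter (¬? ∘ (p ∈?_)) es)
  missed p∈e = ℕ.≰⇒> (λ ≤8 → none (_ , p∈e , ≤8))
  9≤∣es∣ : 9 ≤ length es
  9≤∣es∣ with p , p∈ ← meet (here refl) =
    ℕ.≤-trans (missed (p∩q⊆p e e p∈)) (length-filter (¬? ∘ (p ∈?_)) es)
  few : ∀ {p} → p ∈ˡ elements e → length (filter (p ∈?_) es) ≤ length es ∸ 9
  few {p} p∈ = ℕ.m+n≤o⇒m≤o∸n _ (ℕ.≤-trans (ℕ.+-monoʳ-≤ _ (missed (∈-elements⁻ p∈)))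
    (ℕ.≤-reflexive (sym (length-filter-split (p ∈?_) es))))
  hit : ∀ {x} → x ∈ˡ es → Any (_∈ x) (elements e)
  hit {x} x∈ with q , q∈ ← meet (there x∈) =
    Any.map (λ { refl → p∩q⊆q e x q∈ }) (∈-elements⁺ (p∩q⊆p e x q∈))
  shrink : ∀ {k} → length es ≤ k → length es ≤ 5 * (k ∸ 9)
  shrink ∣es∣≤k = ℕ.≤-trans
    (subst (λ c → length es ≤ c * (length es ∸ 9)) (trans (length-elements e) ∣e∣≡5)
      (union-bound _ (elements e) es few hit))
    (ℕ.*-monoʳ-≤ 5 (ℕ.∸-monoˡ-≤ 9 ∣es∣≤k))

-- Triple systems on eight points

-- The goal (t , s) asks for a member c of the system with c ∩ t ≡ s.
Goal : Set
Goal = Subset 8 × Subset 8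

Met : (Subset 8 → Set) → Goal → Set
Met F (t , s) = ∃ λ c → F c × c ∩ t ≡ s

options : Goal → List (Subset 8) → List (Subset 8)
options (t , s) = filter (λ c → (c ∩ t) ≟ˢ s)

-- Branching where the fewest candidates remain keeps the search tree small.
fewest-options : Goal → List Goal → List (Subset 8) → List (Subset 8)
fewest-options g []       C = options g C
fewest-options g (h ∷ gs) C with options g C | fewest-options h gs C
... | os | os′ = if length os ≤ᵇ length os′ then os else os′

goalsAt : Subset 8 → List Goal
goalsAt t = map (λ e → t , ⁅ e ⁆) (elements t)

-- For sets of size 3, ∣ c ∪ d ∣ ≤ 5 says that c and d intersect.
intersecting : Subset 8 → List (Subset 8) → List (Subset 8)
intersecting c = filter (λ d → ∣ c ∪ d ∣ ℕ.≤? 5)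

without : Subset 8 → List (Subset 8) → List (Subset 8)
without c = filter (λ d → ¬? (d ≟ˢ c))

unmet : List (Subset 8) → List Goal → List Goal
unmet K = filter (λ (t , s) → ¬? (any? (λ c → (c ∩ t) ≟ˢ s) K))

-- K lists the members chosen so far, C the triples not yet excluded.  A branching triple c is
-- either a member, which adds goals and excludes the triples disjoint from c, or is excluded.
refute : (fuel : ℕ) (K : List (Subset 8)) → List Goal → (C : List (Subset 8)) → Bool
branch : (fuel : ℕ) (K : List (Subset 8)) → List Goal → (C : List (Subset 8)) → List (Subset 8) → Bool
refute zero    K gs       C = false
refute (suc k) K []       C = false
refute (suc k) K (g ∷ gs) C = branch k K (g ∷ gs) C (fewest-options g gs C)
branch k K gs C []      = true
branch k K gs C (c ∷ _) =
  refute k (c ∷ K) (unmet (c ∷ K) (goalsAt c ++ gs)) (intersecting c C) ∧ refute k K gs (without c C)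

module _ (F : Subset 8 → Set)
         (F-intersecting : ∀ {c d} → F c → F d → ∣ c ∪ d ∣ ≤ 5)
         (F-critical : ∀ {c e} → F c → e ∈ c → Met F (c , ⁅ e ⁆))
  where

  Complete : List (Subset 8) → Set
  Complete C = ∀ {c} → F c → c ∈ˡ C

  options-member : ∀ {g C} → Met F g → Complete C → ∃ λ c → F c × c ∈ˡ options g C
  options-member {t , s} (c , Fc , eq) all-in = c , Fc , ∈-filter⁺ (λ c → (c ∩ t) ≟ˢ s) (all-in Fc) eq

  fewest-options-member : ∀ {g gs C} → All (Met F) (g ∷ gs) → Complete C →
                          ∃ λ c → F c × c ∈ˡ fewest-options g gs C
  fewest-options-member {g} {[]}             (m ∷ [])     all-in = options-member {g} m all-in
  fewest-options-member {g} {h ∷ gs} {C} (m ∷ ms) all-in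
    with length (options g C) ≤ᵇ length (fewest-options h gs C)
  ... | true  = options-member {g} m all-in
  ... | false = fewest-options-member ms all-in

  goalsAt-met : ∀ {c} → F c → All (Met F) (goalsAt c)
  goalsAt-met Fc = All.map⁺ (All.tabulate (λ e∈ → F-critical Fc (∈-elements⁻ e∈)))

  -- Two invariants: `F` meets every pending goal, and `C` contains all of `F`. Hence a pending goal
  -- without options is a contradiction. Running out of fuel or of goals yields `false` and claims
  -- nothing.
  refute-sound : ∀ k {K gs C} → refute k K gs C ≡ true → All (Met F) gs → Complete C → ⊥
  branch-sound : ∀ k {K gs C os} → branch k K gs C os ≡ true → All (Met F) gs → Complete C →
                 (∃ λ c → F c × c ∈ˡ os) → ⊥
  refute-sound (suc k) {gs = g ∷ gs} ok met all-in =
    branch-sound k ok met all-in (fewest-options-member met all-in)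
  branch-sound k {K} {gs} {C} {c ∷ os} ok met all-in _ = refute-sound k (Bool.∧-conicalʳ with-c without-c ok) met excluded
    where
    with-c    = refute k (c ∷ K) (unmet (c ∷ K) (goalsAt c ++ gs)) (intersecting c C)
    without-c = refute k K gs (without c C)
    -- If `c` were a member, its own goals would be met and all members would intersect it, so the
    -- first subsearch would apply; `unmet` only drops goals.
    c∉F : ¬ F c
    c∉F Fc = refute-sound k (Bool.∧-conicalˡ with-c without-c ok) (All.filter⁺ _ (All.++⁺ (goalsAt-met Fc) met))
      (λ Fd → ∈-filter⁺ (λ d → ∣ c ∪ d ∣ ℕ.≤? 5) (all-in Fd) (F-intersecting Fc Fd))
    excluded : Complete (without c C)
    excluded Fd = ∈-filter⁺ (λ d → ¬? (d ≟ˢ c)) (all-in Fd) (λ { refl → c∉F Fd })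

triples : List (Subset 8)
triples = filter (λ c → ∣ c ∣ ℕ.≟ 3) (subsets 8)

∈-triples : ∀ {c} → ∣ c ∣ ≡ 3 → c ∈ˡ triples
∈-triples {c} = ∈-filter⁺ (λ c → ∣ c ∣ ℕ.≟ 3) {xs = subsets 8} (∈-subsets c)

-- With `t` a singleton, the goal says that some member contains `e`.
singletonGoals : List Goal
singletonGoals = map (λ e → ⁅ e ⁆ , ⁅ e ⁆) (allFin 8)

-- Each of the 56 triples is branched on at most once along a path, so fuel 200 is ample.
refute-triples : refute 200 [] singletonGoals triples ≡ true
refute-triples = refl

no-critical-triple-system :
  (F : Subset 8 → Set) →
  (∀ {c} → F c → ∣ c ∣ ≡ 3) →
  (∀ {c d} → F c → F d → ∣ c ∪ d ∣ ≤ 5) →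
  (∀ e → Met F (⁅ e ⁆ , ⁅ e ⁆)) →
  (∀ {c e} → F c → e ∈ c → Met F (c , ⁅ e ⁆)) →
  ⊥
no-critical-triple-system F size cross cover critical =
  refute-sound F cross critical 200 {[]} {singletonGoals} {triples} refute-triples
    (All.map⁺ (All.universal cover (allFin 8)))
    (∈-triples ∘ size)

-- Intersecting families of 5-sets

module _ {n} (E : Fin 8 → Subset n) (five : ∀ i → ∣ E i ∣ ≡ 5)
         (meet : ∀ i j → Nonempty (E i ∩ E j))
         (uncoverable : ∀ ps → length ps ≤ 3 → ¬ (∀ i → Any (_∈ E i) ps))
  where

  Concurrent : Subset 8 → Set
  Concurrent c = ∃ λ p → ∀ {i} → i ∈ c → p ∈ E i

  Triple : Subset 8 → Set
  Triple c = ∣ c ∣ ≡ 3 × Concurrent c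

  meetingPoint : Fin 8 → Fin 8 → Fin n
  meetingPoint i j = proj₁ (meet i j)

  meetingPoint∈ˡ : ∀ i j → meetingPoint i j ∈ E i
  meetingPoint∈ˡ i j = p∩q⊆p (E i) (E j) (proj₂ (meet i j))

  meetingPoint∈ʳ : ∀ i j → meetingPoint i j ∈ E j
  meetingPoint∈ʳ i j = p∩q⊆q (E i) (E j) (proj₂ (meet i j))

  -- A meeting point serves two edges at once; a last unpaired edge gets a point of its own.
  cover-in-pairs : ∀ k (is : List (Fin 8)) → length is ≤ k * 2 →
                   ∃ λ ps → length ps ≤ k × (∀ {i} → i ∈ˡ is → Any (_∈ E i) ps)
  cover-in-pairs k       []           _  = [] , z≤n , λ ()
  cover-in-pairs (suc k) (i ∷ [])     _  =
    meetingPoint i i ∷ [] , s≤s z≤n , λ { (here refl) → here (meetingPoint∈ˡ i i) }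
  cover-in-pairs (suc k) (i ∷ j ∷ is) le
    with ps , ps≤k , hit ← cover-in-pairs k is (s≤s⁻¹ (s≤s⁻¹ le))
    = meetingPoint i j ∷ ps , s≤s ps≤k , λ
      { (here refl)         → here (meetingPoint∈ˡ i j)
      ; (there (here refl)) → here (meetingPoint∈ʳ i j)
      ; (there (there i∈))  → there (hit i∈) }

  -- Pairing off the edges outside `c` would cost at most `k` vertices, and together with `ps` these
  -- would cover all eight edges.
  many-left : ∀ k ps (c : Subset 8) → (∀ {i} → i ∈ c → Any (_∈ E i) ps) →
              length ps + k ≤ 3 → ¬ (8 ≤ ∣ c ∣ + k * 2)
  many-left k ps c hit few 8≤
    with qs , qs≤k , hit′ ← cover-in-pairs k (elements (∁ c))
           (subst (_≤ k * 2) (sym (trans (length-elements (∁ c)) (∣∁p∣≡n∸∣p∣ c)))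
             (ℕ.m≤n+o⇒m∸n≤o 8 ∣ c ∣ 8≤))
    = uncoverable (ps ++ qs)
        (ℕ.≤-trans (ℕ.≤-reflexive (length-++ ps)) (ℕ.≤-trans (ℕ.+-monoʳ-≤ (length ps) qs≤k) few))
        covers
    where
    covers : ∀ i → Any (_∈ E i) (ps ++ qs)
    covers i with i ∈? c
    ... | yes i∈c = Any.++⁺ˡ (hit i∈c)
    ... | no  i∉c = Any.++⁺ʳ ps (hit′ (∈-elements⁺ (x∉p⇒x∈∁p i∉c)))

  -- A vertex on 4 edges and two meeting points for the other 4 would be a cover by 3.
  concurrent-small : ∀ {c} → Concurrent c → ∣ c ∣ ≤ 3
  concurrent-small {c} (p , p∈) = ℕ.≮⇒≥ λ 4≤∣c∣ →
    many-left 2 (p ∷ []) c (λ i∈ → here (p∈ i∈)) ℕ.≤-refl (ℕ.+-monoˡ-≤ 4 4≤∣c∣)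

  -- Two vertices on 6 edges and one meeting point for the other 2 would be a cover by 3.
  concurrent-intersect : ∀ {c d} → Concurrent c → Concurrent d → ∣ c ∪ d ∣ ≤ 5
  concurrent-intersect {c} {d} (p , p∈) (q , q∈) = ℕ.≮⇒≥ λ 6≤∣c∪d∣ →
    many-left 1 (p ∷ q ∷ []) (c ∪ d)
      (λ i∈ → [ (λ i∈c → here (p∈ i∈c)) , (λ i∈d → there (here (q∈ i∈d))) ]′ (x∈p∪q⁻ c d i∈))
      ℕ.≤-refl (ℕ.+-monoˡ-≤ 2 6≤∣c∪d∣)

  -- The witness is the triple of `a`, `b` and `e`, concurrent at `p`; only `e` among them lies in
  -- `t`.
  triple-through : ∀ {t e a b p} → e ∈ t → a ∉ t → b ∉ t → a ≢ b →
                   p ∈ E e → p ∈ E a → p ∈ E b → Met Triple (t , ⁅ e ⁆)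
  triple-through {t} {e} {a} {b} {p} e∈t a∉t b∉t a≢b p∈e p∈a p∈b =
    c , (size , p , concurrent) , ⊆-antisym only-e has-e
    where
    c = ⁅ a ⁆ ∪ ⁅ b ⁆ ∪ ⁅ e ⁆
    cases : ∀ {i} → i ∈ c → i ≡ a ⊎ i ≡ b ⊎ i ≡ e
    cases i∈ with x∈p∪q⁻ ⁅ a ⁆ _ i∈
    ... | inj₁ i∈a = inj₁ (x∈⁅y⁆⇒x≡y a i∈a)
    ... | inj₂ i∈be with x∈p∪q⁻ ⁅ b ⁆ ⁅ e ⁆ i∈be
    ...   | inj₁ i∈b = inj₂ (inj₁ (x∈⁅y⁆⇒x≡y b i∈b))
    ...   | inj₂ i∈e = inj₂ (inj₂ (x∈⁅y⁆⇒x≡y e i∈e))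
    b∉⁅e⁆ : b ∉ ⁅ e ⁆
    b∉⁅e⁆ b∈ with refl ← x∈⁅y⁆⇒x≡y e b∈ = b∉t e∈t
    a∉⁅b⁆∪⁅e⁆ : a ∉ ⁅ b ⁆ ∪ ⁅ e ⁆
    a∉⁅b⁆∪⁅e⁆ a∈ with x∈p∪q⁻ ⁅ b ⁆ ⁅ e ⁆ a∈
    ... | inj₁ a∈b = a≢b (x∈⁅y⁆⇒x≡y b a∈b)
    ... | inj₂ a∈e with refl ← x∈⁅y⁆⇒x≡y e a∈e = a∉t e∈t
    size : ∣ c ∣ ≡ 3
    size = trans (∣⁅x⁆∪p∣≡1+∣p∣ a∉⁅b⁆∪⁅e⁆)
             (cong suc (trans (∣⁅x⁆∪p∣≡1+∣p∣ b∉⁅e⁆) (cong suc (∣⁅x⁆∣≡1 e))))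
    concurrent : ∀ {i} → i ∈ c → p ∈ E i
    concurrent i∈ with cases i∈
    ... | inj₁ refl        = p∈a
    ... | inj₂ (inj₁ refl) = p∈b
    ... | inj₂ (inj₂ refl) = p∈e
    only-e : c ∩ t ⊆ ⁅ e ⁆
    only-e i∈ with i∈c , i∈t ← x∈p∩q⁻ c t i∈ | cases i∈c
    ... | inj₁ refl        = contradiction i∈t a∉t
    ... | inj₂ (inj₁ refl) = contradiction i∈t b∉t
    ... | inj₂ (inj₂ refl) = x∈⁅x⁆ e
    has-e : ⁅ e ⁆ ⊆ c ∩ t
    has-e i∈ with refl ← x∈⁅y⁆⇒x≡y e i∈ =
      x∈p∩q⁺ (q⊆p∪q ⁅ a ⁆ _ (q⊆p∪q ⁅ b ⁆ ⁅ e ⁆ (x∈⁅x⁆ e)) , e∈t)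

  -- The meeting points of E e with the edges outside t all lie in P, so two of them coincide.
  crowded : ∀ {t e} (P : Subset n) → e ∈ t → (∀ {a} → a ∉ t → meetingPoint e a ∈ P) →
            ∣ P ∣ < ∣ ∁ t ∣ → Met Triple (t , ⁅ e ⁆)
  crowded {t} {e} P e∈t points∈P P<∁t
    with a , b , a∈ , b∈ , a≢b , eq ←
      subset-pigeonhole (∁ t) P (meetingPoint e) (points∈P ∘ x∈∁p⇒x∉p) P<∁t
    = triple-through e∈t (x∈∁p⇒x∉p a∈) (x∈∁p⇒x∉p b∈) a≢b
        (meetingPoint∈ˡ e a) (meetingPoint∈ʳ e a)
        (subst (_∈ E b) (sym eq) (meetingPoint∈ʳ e b))

  -- The seven other edges meet `E e` in its five points, so two of the meeting points coincide.
  triples-cover : ∀ e → Met Triple (⁅ e ⁆ , ⁅ e ⁆)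
  triples-cover e = crowded (E e) (x∈⁅x⁆ e) (λ {a} _ → meetingPoint∈ˡ e a)
    (subst₂ _<_ (sym (five e)) (sym (trans (∣∁p∣≡n∸∣p∣ ⁅ e ⁆) (cong (8 ∸_) (∣⁅x⁆∣≡1 e))))
      (from-yes (5 ℕ.<? 7)))

  -- An edge outside `t` through `p` would put `p` on four edges. So the five edges outside `t` meet
  -- `E e` in its four points other than `p`.
  triples-critical : ∀ {t e} → Triple t → e ∈ t → Met Triple (t , ⁅ e ⁆)
  triples-critical {t} {e} (size , p , p∈) e∈t = crowded (E e - p) e∈t
    (λ {a} a∉t → x∈p∧x≢y⇒x∈p-y (meetingPoint∈ˡ e a)
      (λ eq → p∉ a∉t (subst (_∈ E a) eq (meetingPoint∈ʳ e a))))
    (subst (∣ E e - p ∣ <_) (trans (five e) (sym (trans (∣∁p∣≡n∸∣p∣ t) (cong (8 ∸_) size))))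
      (x∈p⇒∣p-x∣<∣p∣ (p∈ e∈t)))
    where
    p∉ : ∀ {a} → a ∉ t → p ∉ E a
    p∉ {a} a∉t p∈a = ℕ.<⇒≱ (ℕ.≤-reflexive (sym (trans (∣⁅x⁆∪p∣≡1+∣p∣ a∉t) (cong suc size))))
      (concurrent-small {⁅ a ⁆ ∪ t} (p , λ i∈ →
        [ (λ i∈a → subst (λ i → p ∈ E i) (sym (x∈⁅y⁆⇒x≡y a i∈a)) p∈a) , p∈ ]′
          (x∈p∪q⁻ ⁅ a ⁆ t i∈)))

  eight-edges-coverable : ⊥
  eight-edges-coverable = no-critical-triple-system Triple proj₁
    (λ c d → concurrent-intersect (proj₂ c) (proj₂ d)) triples-cover triples-critical

-- Reduction from twelve edges to eight

fit : ∀ {A : Set} {n} → A → List A → Fin n → A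
fit d []       _       = d
fit d (x ∷ xs) zero    = x
fit d (x ∷ xs) (suc i) = fit d xs i

fit-∈ : ∀ {A : Set} {n} (d : A) xs (i : Fin n) → fit d xs i ∈ˡ d ∷ xs
fit-∈ d []       i       = here refl
fit-∈ d (x ∷ xs) zero    = there (here refl)
fit-∈ d (x ∷ xs) (suc i) with fit-∈ d xs i
... | here  ≡d = here ≡d
... | there ∈xs = there (there ∈xs)

fit-onto : ∀ {A : Set} {n} {d x : A} {xs} → length xs ≤ n → x ∈ˡ xs →
           ∃ λ (i : Fin n) → fit d xs i ≡ x
fit-onto (s≤s _)  (here refl) = zero , refl
fit-onto (s≤s le) (there x∈)  with i , eq ← fit-onto le x∈ = suc i , eq

-- At most 8 edges miss the popular vertex `p`; three vertices covering these would form, with `p`,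
-- a cover by 4.
twelve-edges-coverable :
  ∀ {n} (es : List (Subset n)) → length es ≤ 12 →
  (∀ {e} → e ∈ˡ es → ∣ e ∣ ≡ 5) →
  (∀ {e f} → e ∈ˡ es → f ∈ˡ es → Nonempty (e ∩ f)) →
  ¬ (∀ ps → length ps ≤ 4 → ¬ (∀ {e} → e ∈ˡ es → Any (_∈ e) ps))
twelve-edges-coverable []       _     five meet uncoverable = uncoverable [] z≤n (λ ())
twelve-edges-coverable (e ∷ es) short five meet uncoverable
  with p , p∈e , left≤8 ← popular-vertex e es (five (here refl)) (s≤s⁻¹ short) (meet (here refl))
  = eight-edges-coverable E (five ∘ E∈) (λ i j → meet (E∈ i) (E∈ j))
      (λ ps ps≤3 hit → uncoverable (p ∷ ps) (s≤s ps≤3) (covers hit))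
  where
  left = filter (¬? ∘ (p ∈?_)) es
  E : Fin 8 → Subset _
  -- Fewer than 8 edges may be left; the gaps are filled with `e`, which keeps the family
  -- intersecting and 5-uniform.
  E = fit e left
  E∈ : ∀ i → E i ∈ˡ e ∷ es
  E∈ i with fit-∈ e left i
  ... | here  ≡e = here ≡e
  ... | there ∈left = there (proj₁ (∈-filter⁻ (¬? ∘ (p ∈?_)) {xs = es} ∈left))
  covers : ∀ {ps} → (∀ i → Any (_∈ E i) ps) → ∀ {f} → f ∈ˡ e ∷ es → Any (_∈ f) (p ∷ ps)
  covers hit (here refl) = here p∈e
  covers {ps} hit {f} (there f∈) with p ∈? f
  ... | yes p∈f = here p∈f
  ... | no  p∉f
    with i , eq ← fit-onto left≤8 (∈-filter⁺ (¬? ∘ (p ∈?_)) f∈ p∉f)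
    = there (subst (λ f → Any (_∈ f) ps) eq (hit i))

-- Links the covers given as lists of vertices, as built above, to the subsets of `CoveringNumber`.
fromList : ∀ {n} → List (Fin n) → Subset n
fromList = ⋃ ∘ map ⁅_⁆

∣fromList∣≤length : ∀ {n} (ps : List (Fin n)) → ∣ fromList ps ∣ ≤ length ps
∣fromList∣≤length {n} []   = ℕ.≤-reflexive (∣⊥∣≡0 n)
∣fromList∣≤length (p ∷ ps) =
  ℕ.≤-trans (∣⁅x⁆∪p∣≤1+∣p∣ p (fromList ps)) (s≤s (∣fromList∣≤length ps))

∈-fromList : ∀ {n} {ps : List (Fin n)} {p} → p ∈ˡ ps → p ∈ fromList ps
∈-fromList {ps = p ∷ ps} (here refl) = p⊆p∪q (fromList ps) (x∈⁅x⁆ p)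
∈-fromList {ps = p ∷ ps} (there q∈)  = q⊆p∪q ⁅ p ⁆ (fromList ps) (∈-fromList q∈)

lower-bound : (H : Hypergraph) → Uniform 5 H → Intersecting H → CoveringNumber H 5 → 13 ≤ ∣E∣ H
lower-bound H uniform meet (_ , minimal) = ℕ.≮⇒≥ λ short →
  twelve-edges-coverable (edges H) (s≤s⁻¹ short) (All.lookup uniform) meet λ ps ps≤4 hit →
    ℕ.<⇒≱ (s≤s (ℕ.≤-trans (∣fromList∣≤length ps) ps≤4))
      (minimal (fromList ps) (All.tabulate λ {e} e∈ →
        let p , p∈ps , p∈e = find (hit e∈) in p , x∈p∩q⁺ (∈-fromList p∈ps , p∈e)))

-- A hypergraph with 13 edges

block : ℕ → ℕ → ℕ → ℕ → ℕ → Subset 18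
block a b c d e = fromList (map (_mod 18) (a ∷ b ∷ c ∷ d ∷ e ∷ []))

blocks : List (Subset 18)
blocks =
  block 0  1  2 12 15 ∷
  block 0  2  6 11 16 ∷
  block 0  5 13 14 15 ∷
  block 0  7  8  9 10 ∷
  block 1  3  5  6 10 ∷
  block 1  4  6  8 13 ∷
  block 1  9 14 16 17 ∷
  block 2  3  5  8 17 ∷
  block 2  4 10 13 17 ∷
  block 3  7 12 13 16 ∷
  block 4  5  9 11 12 ∷
  block 6  7 12 15 17 ∷
  block 8 10 11 15 16 ∷
  []

-- Exhaustive search with budget `k`: a cover contains some point of the first edge, so each such
-- point is tried and the edges through it are dropped.
no-cover : ∀ {n} → ℕ → List (Subset n) → Bool
no-cover k       []       = false
no-cover zero    (e ∷ es) = true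
no-cover (suc k) (e ∷ es) = all (λ p → no-cover k (filter (¬? ∘ (p ∈?_)) es)) (elements e)

-- Removing from `C` a point `x` of the first edge leaves a smaller set that covers the edges
-- missing `x`.
no-cover-sound : ∀ {n} k (es : List (Subset n)) → T (no-cover k es) →
                 ∀ C → All (λ e → Nonempty (C ∩ e)) es → k < ∣ C ∣
no-cover-sound zero (e ∷ es) ok C ((x , x∈) ∷ _) =
  ℕ.≤-trans (s≤s z≤n) (x∈p⇒∣p-x∣<∣p∣ (p∩q⊆p C e x∈))
no-cover-sound (suc k) (e ∷ es) ok C ((x , x∈) ∷ hit)
  with x∈C , x∈e ← x∈p∩q⁻ C e x∈
  = ℕ.≤-<-trans (no-cover-sound k left (All.lookup (All.all⁺ _ _ ok) (∈-elements⁺ x∈e)) (C - x)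
      (All.tabulate hit′)) (x∈p⇒∣p-x∣<∣p∣ x∈C)
  where
  left = filter (¬? ∘ (x ∈?_)) es
  hit′ : ∀ {f} → f ∈ˡ left → Nonempty ((C - x) ∩ f)
  hit′ {f} f∈ with f∈es , x∉f ← ∈-filter⁻ (¬? ∘ (x ∈?_)) {xs = es} f∈
    with y , y∈ ← All.lookup hit f∈es with y∈C , y∈f ← x∈p∩q⁻ C f y∈
    = y , x∈p∩q⁺ (x∈p∧x≢y⇒x∈p-y y∈C (λ { refl → x∉f y∈f }) , y∈f)

blocks-intersect : All (λ e → All (λ f → Nonempty (e ∩ f)) blocks) blocks
blocks-intersect = from-yes (all? (λ e → all? (λ f → nonempty? (e ∩ f)) blocks) blocks)

blocks-uniform : All (λ e → ∣ e ∣ ≡ 5) blocks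
blocks-uniform = from-yes (all? (λ e → ∣ e ∣ ℕ.≟ 5) blocks)

example : Hypergraph
example = record { n = 18 ; edges = blocks ; simple = from-yes (unique? _≟ˢ_ blocks) }

example-covering-number : CoveringNumber example 5
example-covering-number =
  -- The first edge is itself a cover, as the edges pairwise intersect; the search with budget 4
  -- excludes smaller ones.
  (block 0 1 2 12 15 , All.lookup blocks-intersect (here refl) , refl) ,
  λ C → no-cover-sound 4 blocks _ C

mainTheorem1 : Σ Hypergraph (λ H → Uniform 5 H × Intersecting H × CoveringNumber H 5 × ∣E∣ H ≡ 13)
    × (∀ (H : Hypergraph) → Uniform 5 H → Intersecting H → CoveringNumber H 5 → 13 ≤ ∣E∣ H)
mainTheorem1 =
  (example , blocks-uniform
           , (λ e∈ f∈ → All.lookup (All.lookup blocks-intersect e∈) f∈)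
           , example-covering-number
           , refl)
  , lower-bound
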